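{- For each of the following sets $P=Q\cup\{r\}$ of five generalized patterns there is an integer $k$ such that $|S_n(P)|=2$ for every $n\ge k$. (a) $r=21\text{ - }3$ and $Q$ one of: $\{1\text{ - }23,2\text{ - }13,x,y\}$ with $x\in\{1\text{ - }32,13\text{ - }2\}$, $y\in\{3\text{ - }12,31\text{ - }2\}$; $\{1\text{ - }23,2\text{ - }13,x,y\}$ with $x\in\{2\text{ - }31,23\text{ - }1\}$, $y\in\{1\text{ - }32,13\text{ - }2,3\text{ - }12,31\text{ - }2\}$; $\{12\text{ - }3,2\text{ - }13,x,32\text{ - }1\}$ with $x\in\{2\text{ - }31,23\text{ - }1\}$; $\{2\text{ - }13,2\text{ - }31,1\text{ - }32,3\text{ - }12\}$, $\{2\text{ - }13,2\text{ - }31,1\text{ - }32,31\text{ - }2\}$, $\{2\text{ - }13,2\text{ - }31,13\text{ - }2,31\text{ - }2\}$; $\{2\text{ - }13,23\text{ - }1,x,y\}$ with $x\in\{1\text{ - }32,13\text{ - }2\}$, $y\in\{3\text{ - }12,31\text{ - }2\}$. (b) $r=3\text{ - }12$ and $Q$ one of: $\{1\text{ - }23,2\text{ - }13,x,31\text{ - }2\}$ with $x\in\{2\text{ - }31,23\text{ - }1,1\text{ - }32,13\text{ - }2\}$; $\{1\text{ - }23,21\text{ - }3,x,31\text{ - }2\}$ with $x\in\{1\text{ - }32,13\text{ - }2\}$; $\{1\text{ - }23,2\text{ - }31,x,31\text{ - }2\}$ with $x\in\{1\text{ - }32,13\text{ - }2\}$; $\{1\text{ - }23,23\text{ - }1,x,31\text{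 - }2\}$ with $x\in\{1\text{ - }32,13\text{ - }2\}$. (c) $r=23\text{ - }1$ and $Q$ one of: $\{2\text{ - }13,2\text{ - }31,1\text{ - }32,31\text{ - }2\}$; $\{1\text{ - }23,2\text{ - }31,x,y\}$ with $x\in\{1\text{ - }32,13\text{ - }2\}$, $y\in\{3\text{ - }12,31\text{ - }2\}$; $\{1\text{ - }23,21\text{ - }3,2\text{ - }31,x\}$ with $x\in\{1\text{ - }32,13\text{ - }2,3\text{ - }12,31\text{ - }2\}$; $\{1\text{ - }23,2\text{ - }13,2\text{ - }31,x\}$ with $x\in\{1\text{ - }32,13\text{ - }2,3\text{ - }12,31\text{ - }2\}$. (d) $r=1\text{ - }32$ and $Q$ one of: $\{1\text{ - }23,2\text{ - }13,x,13\text{ - }2\}$ with $x\in\{2\text{ - }31,23\text{ - }1,3\text{ - }12,31\text{ - }2\}$; $\{1\text{ - }23,21\text{ - }3,x,13\text{ - }2\}$ with $x\in\{2\text{ - }31,23\text{ - }1,3\text{ - }12,31\text{ - }2\}$; $\{1\text{ - }23,2\text{ - }31,13\text{ - }2,x\}$ with $x\in\{3\text{ - }12,31\text{ - }2\}$; $\{1\text{ - }23,23\text{ - }1,13\text{ - }2,x\}$ with $x\in\{3\text{ - }12,31\text{ - }2\}$. (e) $r=12\text{ - }3$ and $Q$ one of: $\{1\text{ - }23,2\text{ - }13,x,y\}$ with $x\in\{2\text{ - }31,23\text{ - }1\}$, $y\in\{1\text{ - }32,13\text{ - }2,3\text{ - }12,31\text{ - }2\}$; $\{1\text{ - }23,2\text{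 - }13,1\text{ - }32,x\}$ with $x\in\{3\text{ - }12,31\text{ - }2\}$; $\{1\text{ - }23,21\text{ - }3,x,y\}$ with $x\in\{2\text{ - }31,23\text{ - }1\}$, $y\in\{1\text{ - }32,3\text{ - }12,31\text{ - }2\}$.
   Context: $S_n$ is the set of permutations $\pi=\pi_1\pi_2\cdots\pi_n$ of $\{1,\dots,n\}$. For $abc$ a permutation of $123$, the generalized pattern $a\text{ - }bc$ is contained in $\pi$ if there are indices $i<j$ with $j+1\le n$ such that $\pi_i\pi_j\pi_{j+1}$ is order-isomorphic to $abc$; the generalized pattern $ab\text{ - }c$ is contained in $\pi$ if there are indices $i,k$ with $i+1<k\le n$ such that $\pi_i\pi_{i+1}\pi_k$ is order-isomorphic to $abc$. (Letters not separated by a dash must occur in adjacent positions; letters separated by a dash need not be adjacent.) $\pi$ avoids a pattern if it does not contain it. For a set $P$ of generalized patterns, $S_n(P)$ is the set of $\pi\in S_n$ avoiding every pattern in $P$. -}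

module Defs where

open import Data.Fin.Base using (Fin; toℕ) renaming (_<_ to _<ᶠ_)
open import Data.Fin.Patterns using (0F; 1F; 2F)
open import Data.Fin.Permutation using (Permutation′; _⟨$⟩ʳ_)
open import Data.Fin.Properties using (_≟_)
open import Data.List.Base using (List; []; _∷_)
open import Data.List.Membership.Propositional using (_∈_)
open import Data.List.Relation.Unary.All using (All)
open import Data.List.Relation.Unary.Unique.DecPropositional (_≟_ {3}) using (unique?)
open import Data.Nat.Base using (ℕ; suc)
open import Data.Product.Base using (Σ; ∃-syntax; _×_; proj₁)
open import Data.Vec.Base using (Vec; []; _∷_; lookup; map; toList)
open import Function.Bundles using (Inverse; _⇔_)
open import Level using (0ℓ)
open import Relation.Binary.Bundles using (Setoid)
import Relation.Binary.Construct.On as On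
open import Relation.Binary.PropositionalEquality using (_≡_; setoid; _→-setoid_)
open import Relation.Nullary.Decidable using (True)
open import Relation.Nullary.Negation using (¬_)

-- The position of the dash in a generalized pattern.
data Shape : Set where
  a-bc ab-c : Shape

-- Letters and permutations are 0-based: the letters 1, 2, 3 are 0F, 1F, 2F, and
-- a permutation of {1,…,n} is a permutation of Fin n.
record GenPattern : Set where
  constructor pattern′
  field
    shape      : Shape
    letters    : Vec (Fin 3) 3
    {distinct} : True (unique? (toList letters))

open GenPattern public

1-23 1-32 2-13 2-31 3-12 : GenPattern
1-23 = pattern′ a-bc (0F ∷ 1F ∷ 2F ∷ [])
1-32 = pattern′ a-bc (0F ∷ 2F ∷ 1F ∷ [])
2-13 = pattern′ a-bc (1F ∷ 0F ∷ 2F ∷ [])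
2-31 = pattern′ a-bc (1F ∷ 2F ∷ 0F ∷ [])
3-12 = pattern′ a-bc (2F ∷ 0F ∷ 1F ∷ [])

12-3 13-2 21-3 23-1 31-2 32-1 : GenPattern
12-3 = pattern′ ab-c (0F ∷ 1F ∷ 2F ∷ [])
13-2 = pattern′ ab-c (0F ∷ 2F ∷ 1F ∷ [])
21-3 = pattern′ ab-c (1F ∷ 0F ∷ 2F ∷ [])
23-1 = pattern′ ab-c (1F ∷ 2F ∷ 0F ∷ [])
31-2 = pattern′ ab-c (2F ∷ 0F ∷ 1F ∷ [])
32-1 = pattern′ ab-c (2F ∷ 1F ∷ 0F ∷ [])

OrderIsomorphic : ∀ {l m n} → Vec (Fin m) l → Vec (Fin n) l → Set
OrderIsomorphic u v =
  ∀ s t → (lookup u s <ᶠ lookup u t) ⇔ (lookup v s <ᶠ lookup v t)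

Admissible : ∀ {n} → Shape → (i j k : Fin n) → Set
Admissible a-bc i j k = (i <ᶠ j) × (toℕ k ≡ suc (toℕ j))
Admissible ab-c i j k = (toℕ j ≡ suc (toℕ i)) × (j <ᶠ k)

Contains : ∀ {n} → Permutation′ n → GenPattern → Set
Contains π p = ∃[ i ] ∃[ j ] ∃[ k ]
  Admissible (shape p) i j k ×
  OrderIsomorphic (map (π ⟨$⟩ʳ_) (i ∷ j ∷ k ∷ [])) (letters p)

Avoids : ∀ {n} → Permutation′ n → GenPattern → Set
Avoids π p = ¬ Contains π p

-- Two elements are equal when their underlying permutations agree pointwise,
-- since propositional equality would also compare the proofs they carry.
-- The finite set P is given by a list; order and repetition play no role.
S : ℕ → List GenPattern → Setoid 0ℓ 0ℓ
S n P = On.setoid {B = Σ (Permutation′ n) λ π → All (Avoids π) P}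
  (Fin n →-setoid Fin n) (λ σ → proj₁ σ ⟨$⟩ʳ_)

∣_∣≡_ : Setoid 0ℓ 0ℓ → ℕ → Set
∣ A ∣≡ m = Inverse (setoid (Fin m)) A

-- Listed r Q: the theorem is stated for P = Q ∪ {r}.
data Listed : GenPattern → List GenPattern → Set where

  a₁ : ∀ {x y} → x ∈ 1-32 ∷ 13-2 ∷ [] → y ∈ 3-12 ∷ 31-2 ∷ [] →
       Listed 21-3 (1-23 ∷ 2-13 ∷ x ∷ y ∷ [])
  a₂ : ∀ {x y} → x ∈ 2-31 ∷ 23-1 ∷ [] → y ∈ 1-32 ∷ 13-2 ∷ 3-12 ∷ 31-2 ∷ [] →
       Listed 21-3 (1-23 ∷ 2-13 ∷ x ∷ y ∷ [])
  a₃ : ∀ {x} → x ∈ 2-31 ∷ 23-1 ∷ [] →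
       Listed 21-3 (12-3 ∷ 2-13 ∷ x ∷ 32-1 ∷ [])
  a₄ : Listed 21-3 (2-13 ∷ 2-31 ∷ 1-32 ∷ 3-12 ∷ [])
  a₅ : Listed 21-3 (2-13 ∷ 2-31 ∷ 1-32 ∷ 31-2 ∷ [])
  a₆ : Listed 21-3 (2-13 ∷ 2-31 ∷ 13-2 ∷ 31-2 ∷ [])
  a₇ : ∀ {x y} → x ∈ 1-32 ∷ 13-2 ∷ [] → y ∈ 3-12 ∷ 31-2 ∷ [] →
       Listed 21-3 (2-13 ∷ 23-1 ∷ x ∷ y ∷ [])

  b₁ : ∀ {x} → x ∈ 2-31 ∷ 23-1 ∷ 1-32 ∷ 13-2 ∷ [] →
       Listed 3-12 (1-23 ∷ 2-13 ∷ x ∷ 31-2 ∷ [])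
  b₂ : ∀ {x} → x ∈ 1-32 ∷ 13-2 ∷ [] →
       Listed 3-12 (1-23 ∷ 21-3 ∷ x ∷ 31-2 ∷ [])
  b₃ : ∀ {x} → x ∈ 1-32 ∷ 13-2 ∷ [] →
       Listed 3-12 (1-23 ∷ 2-31 ∷ x ∷ 31-2 ∷ [])
  b₄ : ∀ {x} → x ∈ 1-32 ∷ 13-2 ∷ [] →
       Listed 3-12 (1-23 ∷ 23-1 ∷ x ∷ 31-2 ∷ [])

  c₁ : Listed 23-1 (2-13 ∷ 2-31 ∷ 1-32 ∷ 31-2 ∷ [])
  c₂ : ∀ {x y} → x ∈ 1-32 ∷ 13-2 ∷ [] → y ∈ 3-12 ∷ 31-2 ∷ [] →
       Listed 23-1 (1-23 ∷ 2-31 ∷ x ∷ y ∷ [])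
  c₃ : ∀ {x} → x ∈ 1-32 ∷ 13-2 ∷ 3-12 ∷ 31-2 ∷ [] →
       Listed 23-1 (1-23 ∷ 21-3 ∷ 2-31 ∷ x ∷ [])
  c₄ : ∀ {x} → x ∈ 1-32 ∷ 13-2 ∷ 3-12 ∷ 31-2 ∷ [] →
       Listed 23-1 (1-23 ∷ 2-13 ∷ 2-31 ∷ x ∷ [])

  d₁ : ∀ {x} → x ∈ 2-31 ∷ 23-1 ∷ 3-12 ∷ 31-2 ∷ [] →
       Listed 1-32 (1-23 ∷ 2-13 ∷ x ∷ 13-2 ∷ [])
  d₂ : ∀ {x} → x ∈ 2-31 ∷ 23-1 ∷ 3-12 ∷ 31-2 ∷ [] →
       Listed 1-32 (1-23 ∷ 21-3 ∷ x ∷ 13-2 ∷ [])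
  d₃ : ∀ {x} → x ∈ 3-12 ∷ 31-2 ∷ [] →
       Listed 1-32 (1-23 ∷ 2-31 ∷ 13-2 ∷ x ∷ [])
  d₄ : ∀ {x} → x ∈ 3-12 ∷ 31-2 ∷ [] →
       Listed 1-32 (1-23 ∷ 23-1 ∷ 13-2 ∷ x ∷ [])

  e₁ : ∀ {x y} → x ∈ 2-31 ∷ 23-1 ∷ [] → y ∈ 1-32 ∷ 13-2 ∷ 3-12 ∷ 31-2 ∷ [] →
       Listed 12-3 (1-23 ∷ 2-13 ∷ x ∷ y ∷ [])
  e₂ : ∀ {x} → x ∈ 3-12 ∷ 31-2 ∷ [] →
       Listed 12-3 (1-23 ∷ 2-13 ∷ 1-32 ∷ x ∷ [])
  e₃ : ∀ {x y} → x ∈ 2-31 ∷ 23-1 ∷ [] → y ∈ 1-32 ∷ 3-12 ∷ 31-2 ∷ [] →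
       Listed 12-3 (1-23 ∷ 21-3 ∷ x ∷ y ∷ [])

{-# OPTIONS --safe #-}
module Submission where

-- Record the ascents of π as a word of Booleans. Avoiding 213 and 231 (in either
-- shape) means that every letter compares with all later letters as it does with
-- the next one; avoiding 132 and 312 is the mirror statement about earlier
-- letters. In both cases the word determines π, and the order of three
-- consecutive letters is a function of two consecutive letters of the word. The
-- other patterns of P leave just two transitions between consecutive letters,
-- such that one letter of the word is free and determines the rest.

open import Defs
open import Data.Bool.Base using (Bool; true; false; not; _∧_)
import Data.Bool.Properties as Bool
open import Data.Fin.Base using (Fin; zero; suc; toℕ; fromℕ; inject₁; opposite; punchIn) renaming (_<_ to _<ᶠ_)
open import Data.Fin.Patterns using (0F; 1F; 2F)
open import Data.Fin.Permutation using (Permutation′; _⟨$⟩ʳ_; _⟨$⟩ˡ_; inverseˡ; inverseʳ; id; insert; insert-punchIn; reverse; _∘ₚ_)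
open import Data.Fin.Properties as Fin using (2↔Bool; _<?_; all?)
open import Data.List.Base using (List; []; _∷_)
open import Data.List.Membership.Propositional using (_∈_; find)
open import Data.List.Relation.Unary.All as All using (All)
open import Data.List.Relation.Unary.Any as Any using (Any)
open import Data.Nat.Base using (ℕ; zero; suc; pred; 2+; _≤_; _<_; _≥_; _∸_; _≡ᵇ_; z≤n; s≤s; s≤s⁻¹; z<s; _≤′_; ≤′-reflexive; ≤′-step; _≤‴_; ≤‴-refl; ≤‴-step)
open import Data.Nat.DivMod using (_mod_; m<n⇒m%n≡m)
import Data.Nat.Properties as ℕ
open import Data.Product.Base using (∃-syntax; _×_; _,_; proj₁; proj₂)
open import Data.Sum.Base using (_⊎_; inj₁; inj₂)
open import Data.Unit.Base using (⊤; tt)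
open import Data.Vec.Base using (Vec; []; _∷_; lookup; map)
open import Data.Vec.Properties using (lookup-map; ≡-dec)
open import Function.Base using (_∘_)
open import Function.Bundles using (mk⇔; Equivalence; Injection)
import Function.Construct.Composition as Composition
open import Function.Properties.Inverse using (↔⇒↣)
open import Relation.Binary.Definitions using (tri<; tri≈; tri>)
open import Relation.Binary.PropositionalEquality using (_≡_; _≢_; refl; sym; trans; cong; cong₂; subst; subst₂)
open import Relation.Nullary.Decidable using (Dec; yes; does; True; toWitness; map′; _×-dec_; _⊎-dec_; _→-dec_; ¬?; dec-true; dec-false)
open import Relation.Nullary.Negation using (¬_; contradiction)

-- Order isomorphism

-- The letters of `l` act as ranks into the chain x < y < z. A strictly increasing map between
-- linear orders also reflects the order, so monotonicity on `Fin 3` suffices.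
sorted-iso : ∀ {n} {x y z : Fin n} → x <ᶠ y → y <ᶠ z → (l : Vec (Fin 3) 3) →
             OrderIsomorphic (map (lookup (x ∷ y ∷ z ∷ [])) l) l
sorted-iso {x = x} {y} {z} x<y y<z l s t
  rewrite lookup-map s (lookup (x ∷ y ∷ z ∷ [])) l
        | lookup-map t (lookup (x ∷ y ∷ z ∷ [])) l = mk⇔ reflects mono
  where
  w : Fin 3 → _
  w = lookup (x ∷ y ∷ z ∷ [])

  mono : ∀ {a b} → a <ᶠ b → w a <ᶠ w b
  mono {0F} {1F} _ = x<y
  mono {0F} {2F} _ = Fin.<-trans x<y y<z
  mono {1F} {2F} _ = y<z
  mono {1F} {1F} (s≤s ())
  mono {2F} {1F} (s≤s ())
  mono {2F} {2F} (s≤s (s≤s ()))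

  reflects : ∀ {a b} → w a <ᶠ w b → a <ᶠ b
  reflects {a} {b} wa<wb with Fin.<-cmp a b
  ... | tri< a<b _ _ = a<b
  ... | tri≈ _ refl _ = contradiction wa<wb (ℕ.<-irrefl refl)
  ... | tri> _ _ b<a = contradiction wa<wb (Fin.<-asym (mono b<a))

-- With `u` a triple of values in a permutation, this replaces containment by a comparison of two
-- letter vectors over `Fin 3`, which is settled by computation.
iso-sym-trans : ∀ {l m n o} (u : Vec (Fin m) l) (v : Vec (Fin n) l) (w : Vec (Fin o) l) →
                OrderIsomorphic u v → OrderIsomorphic u w → OrderIsomorphic v w
iso-sym-trans u v w u≅v u≅w s t =
  mk⇔ (to (u≅w s t) ∘ from (u≅v s t)) (to (u≅v s t) ∘ from (u≅w s t))
  where open Equivalence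

_≅?_ : ∀ {l m n} (u : Vec (Fin m) l) (v : Vec (Fin n) l) → Dec (OrderIsomorphic u v)
u ≅? v = all? λ s → all? λ t →
  map′ (λ (f , g) → mk⇔ f g) (λ e → Equivalence.to e , Equivalence.from e)
    (((lookup u s <? lookup u t) →-dec (lookup v s <? lookup v t)) ×-dec
     ((lookup v s <? lookup v t) →-dec (lookup u s <? lookup u t)))

Compare : ∀ {n} → Bool → Fin n → Fin n → Set
Compare true  x y = x <ᶠ y
Compare false x y = y <ᶠ x

compare-total : ∀ {n} b {x y : Fin n} → x ≢ y → Compare b x y ⊎ Compare b y x
compare-total b {x} {y} x≢y with b | Fin.<-cmp x y
... | true  | tri< x<y _ _ = inj₁ x<y
... | true  | tri> _ _ y<x = inj₂ y<x
... | false | tri< x<y _ _ = inj₂ x<y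
... | false | tri> _ _ y<x = inj₁ y<x
... | _     | tri≈ _ x≡y _ = contradiction x≡y x≢y

does-compare : ∀ {n} b {x y : Fin n} → Compare b x y → does (x <? y) ≡ b
does-compare true  {x} {y} x<y = dec-true  (x <? y) x<y
does-compare false {x} {y} y<x = dec-false (x <? y) (Fin.<-asym y<x)

compare-does : ∀ {n} {x y : Fin n} → x ≢ y → Compare (does (x <? y)) x y
compare-does {x = x} {y} x≢y with compare-total true x≢y
... | inj₁ x<y = subst (λ b → Compare b x y) (sym (does-compare true x<y)) x<y
... | inj₂ y<x = subst (λ b → Compare b x y) (sym (does-compare false y<x)) y<x

compare-transfer : ∀ {n} b c {x y x′ y′ : Fin n} → Compare b x y → Compare b x′ y′ →
                   Compare c x y → Compare c x′ y′
compare-transfer true  true  _   x′<y′ _   = x′<y′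
compare-transfer false false _   y′<x′ _   = y′<x′
compare-transfer true  false x<y _     y<x = contradiction x<y (Fin.<-asym y<x)
compare-transfer false true  y<x _     x<y = contradiction x<y (Fin.<-asym y<x)

compare-flip : ∀ {n} b {x y : Fin n} → Compare (not b) x y → Compare b y x
compare-flip true  y<x = y<x
compare-flip false x<y = x<y

-- Permutations governed by a word of ascents

-- A permutation is governed from the left if the comparison of any two letters
-- is that of the left one with its successor; it is governed from the right if
-- it is that of the right one with its predecessor.
data Side : Set where
  left right : Side

-- Ascent t compares the positions t and t + 1, so the comparison of j with its predecessor carries
-- the index `pred j`. It is applied to i < j only, where j is positive.
key : Side → ℕ → ℕ → ℕ
key left  i j = i
key right i j = pred j

key-≤ : ∀ s {m i j} → i < j → j < 2+ m → key s i j ≤ m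
key-≤ left  i<j           j<n = s≤s⁻¹ (ℕ.≤-trans i<j (s≤s⁻¹ j<n))
key-≤ right {j = suc k} _ j<n = s≤s⁻¹ (s≤s⁻¹ j<n)

key-< : ∀ s {i j k} → i < j → j < k → key s i j < key s j k
key-< left                        i<j j<k       = i<j
key-< right {j = suc j} {suc k} _   (s≤s j<k) = j<k

Follows : ∀ {n} → Side → (ℕ → Bool) → Permutation′ n → Set
Follows {n} s w π = {i j : Fin n} → i <ᶠ j →
  Compare (w (key s (toℕ i) (toℕ j))) (π ⟨$⟩ʳ i) (π ⟨$⟩ʳ j)

⟨$⟩ʳ-injective : ∀ {n} (π : Permutation′ n) {i j} → π ⟨$⟩ʳ i ≡ π ⟨$⟩ʳ j → i ≡ j
⟨$⟩ʳ-injective π = Injection.injective (↔⇒↣ π)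

-- The domain and codomain sizes are independent so that the induction can restrict `f` along
-- `inject₁` while its codomain stays fixed.
strictlyMono⇒≤ : ∀ {m n} (f : Fin m → Fin n) → (∀ {i j} → i <ᶠ j → f i <ᶠ f j) →
                 ∀ i → toℕ i ≤ toℕ (f i)
strictlyMono⇒≤ f mono zero    = z≤n
strictlyMono⇒≤ f mono (suc i) = ℕ.≤-<-trans
  (strictlyMono⇒≤ (f ∘ inject₁)
    (λ {i} {j} → mono ∘ subst₂ _<_ (sym (Fin.toℕ-inject₁ i)) (sym (Fin.toℕ-inject₁ j))) i)
  (mono (s≤s (ℕ.≤-reflexive (Fin.toℕ-inject₁ i))))

-- Both permutations order any two positions alike, so σ after the inverse of π is strictly
-- increasing and lies above the identity. Exchanging π and σ then gives equality.
follows-≤ : ∀ {n} s w (π σ : Permutation′ n) → Follows s w π → Follows s w σ →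
            ∀ i → toℕ (π ⟨$⟩ʳ i) ≤ toℕ (σ ⟨$⟩ʳ i)
follows-≤ s w π σ followsπ followsσ i =
  subst (λ j → toℕ (π ⟨$⟩ʳ i) ≤ toℕ (σ ⟨$⟩ʳ j)) (inverseˡ π)
    (strictlyMono⇒≤ (λ x → σ ⟨$⟩ʳ (π ⟨$⟩ˡ x))
      (λ x<y → transfer (subst₂ _<ᶠ_ (sym (inverseʳ π)) (sym (inverseʳ π)) x<y))
      (π ⟨$⟩ʳ i))
  where
  transfer : ∀ {i j} → π ⟨$⟩ʳ i <ᶠ π ⟨$⟩ʳ j → σ ⟨$⟩ʳ i <ᶠ σ ⟨$⟩ʳ j
  transfer {i} {j} πi<πj with Fin.<-cmp i j
  ... | tri< i<j _ _ = compare-transfer _ true (followsπ i<j) (followsσ i<j) πi<πj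
  ... | tri≈ _ refl _ = contradiction πi<πj (ℕ.<-irrefl refl)
  ... | tri> _ _ j<i = compare-transfer _ false (followsπ j<i) (followsσ j<i) πi<πj

follows-unique : ∀ {n} s w (π σ : Permutation′ n) → Follows s w π → Follows s w σ →
                 ∀ i → π ⟨$⟩ʳ i ≡ σ ⟨$⟩ʳ i
follows-unique s w π σ followsπ followsσ i = Fin.toℕ-injective (ℕ.≤-antisym
  (follows-≤ s w π σ followsπ followsσ i) (follows-≤ s w σ π followsσ followsπ i))

punchIn-mono-< : ∀ {n} i {j k : Fin n} → j <ᶠ k → punchIn i j <ᶠ punchIn i k
punchIn-mono-< i {j} {k} j<k = Fin.≤∧≢⇒< (Fin.punchIn-mono-≤ i j k (ℕ.<⇒≤ j<k))
  (λ eq → Fin.<⇒≢ j<k (Fin.punchIn-injective i j k eq))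

extreme : ∀ n → Bool → Fin (suc n)
extreme n true  = zero
extreme n false = fromℕ n

extreme-compare : ∀ {n} b (x : Fin n) → Compare b (extreme n b) (punchIn (extreme n b) x)
extreme-compare     true  x = z<s
extreme-compare {n} false x =
  Fin.≤∧≢⇒< (Fin.≤fromℕ (punchIn (fromℕ n) x)) (Fin.punchInᵢ≢i (fromℕ n) x)

punchIn-compare : ∀ {n} b i {j k : Fin n} → Compare b j k → Compare b (punchIn i j) (punchIn i k)
punchIn-compare true  i = punchIn-mono-< i
punchIn-compare false i = punchIn-mono-< i

-- Governed from the left, the first letter lies below all others or above all others, as `w 0`
-- dictates. It is put in front, and the recursive arrangement is renumbered around it by `punchIn`.
arrangeˡ : ∀ n → (ℕ → Bool) → Permutation′ n
arrangeˡ zero    w = id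
arrangeˡ (suc n) w = insert zero (extreme n (w 0)) (arrangeˡ n (w ∘ suc))

arrangeˡ-follows : ∀ n w → Follows left w (arrangeˡ n w)
arrangeˡ-follows (suc n) w {zero}  {suc j} _
  rewrite insert-punchIn zero (extreme n (w 0)) (arrangeˡ n (w ∘ suc)) j =
  extreme-compare (w 0) (arrangeˡ n (w ∘ suc) ⟨$⟩ʳ j)
arrangeˡ-follows (suc n) w {suc i} {suc j} (s≤s i<j)
  rewrite insert-punchIn zero (extreme n (w 0)) (arrangeˡ n (w ∘ suc)) i
        | insert-punchIn zero (extreme n (w 0)) (arrangeˡ n (w ∘ suc)) j =
  punchIn-compare _ (extreme n (w 0)) (arrangeˡ-follows n (w ∘ suc) i<j)

-- Reversal exchanges the two sides and negates each comparison. Position t of the reversed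
-- permutation is position `n ∸ suc t` of this one, whose comparison with its predecessor has the
-- index `pred` of that.
arrangeʳ : ∀ n → (ℕ → Bool) → Permutation′ n
arrangeʳ n w = reverse ∘ₚ arrangeˡ n (λ t → not (w (pred (n ∸ suc t))))

opposite-anti : ∀ {n} {i j : Fin n} → i <ᶠ j → opposite j <ᶠ opposite i
opposite-anti {n} {i} {j} i<j
  rewrite Fin.opposite-prop i | Fin.opposite-prop j =
  ℕ.∸-monoʳ-< (s≤s i<j) (Fin.toℕ<n j)

arrangeʳ-follows : ∀ n w → Follows right w (arrangeʳ n w)
arrangeʳ-follows n w {i} {j} i<j = compare-flip _
  (subst (λ t → Compare (not (w (pred t))) (arrangeʳ n w ⟨$⟩ʳ j) (arrangeʳ n w ⟨$⟩ʳ i)) double-opposite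
    (arrangeˡ-follows n _ (opposite-anti i<j)))
  where
  double-opposite : n ∸ suc (toℕ (opposite j)) ≡ toℕ j
  double-opposite = trans (sym (Fin.opposite-prop (opposite j)))
                          (cong toℕ (Fin.opposite-involutive j))

arrange : Side → ∀ n → (ℕ → Bool) → Permutation′ n
arrange left  = arrangeˡ
arrange right = arrangeʳ

arrange-follows : ∀ s n w → Follows s w (arrange s n w)
arrange-follows left  = arrangeˡ-follows
arrange-follows right = arrangeʳ-follows

-- The two Booleans are the letters of the word at key s i j and key s j k, for
-- the positions i < j < k of the triple.
triple : Side → Bool → Bool → Vec (Fin 3) 3
triple left  true  true  = letters 1-23
triple left  true  false = letters 1-32
triple left  false true  = letters 3-12
triple left  false false = letters 32-1
triple right true  true  = letters 1-23
triple right true  false = letters 2-31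
triple right false true  = letters 2-13
triple right false false = letters 32-1

-- Governed from the left, the outer pair is compared as the first pair is; from the right, as the
-- second pair is.
triple-isoˡ : ∀ {n} a b {x y z : Fin n} → Compare a x y → Compare a x z → Compare b y z →
              OrderIsomorphic (x ∷ y ∷ z ∷ []) (triple left a b)
triple-isoˡ true  true  x<y x<z y<z = sorted-iso x<y y<z (letters 1-23)
triple-isoˡ true  false x<y x<z z<y = sorted-iso x<z z<y (letters 1-32)
triple-isoˡ false true  y<x z<x y<z = sorted-iso y<z z<x (letters 3-12)
triple-isoˡ false false y<x z<x z<y = sorted-iso z<y y<x (letters 32-1)

triple-isoʳ : ∀ {n} a b {x y z : Fin n} → Compare a x y → Compare b x z → Compare b y z →
              OrderIsomorphic (x ∷ y ∷ z ∷ []) (triple right a b)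
triple-isoʳ true  true  x<y x<z y<z = sorted-iso x<y y<z (letters 1-23)
triple-isoʳ true  false x<y z<x z<y = sorted-iso z<x x<y (letters 2-31)
triple-isoʳ false true  y<x x<z y<z = sorted-iso y<x x<z (letters 2-13)
triple-isoʳ false false y<x z<x z<y = sorted-iso z<y y<x (letters 32-1)

follows-triple : ∀ {n} s w (π : Permutation′ n) → Follows s w π → ∀ {i j k} → i <ᶠ j → j <ᶠ k →
                 OrderIsomorphic (map (π ⟨$⟩ʳ_) (i ∷ j ∷ k ∷ []))
                   (triple s (w (key s (toℕ i) (toℕ j))) (w (key s (toℕ j) (toℕ k))))
follows-triple left  w π follows i<j j<k =
  triple-isoˡ _ _ (follows i<j) (follows (Fin.<-trans i<j j<k)) (follows j<k)
follows-triple right w π follows i<j j<k =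
  triple-isoʳ _ _ (follows i<j) (follows (Fin.<-trans i<j j<k)) (follows j<k)

-- Words with one free letter

data Rule : Set where
  constant headFree lastFree alternating : Rule

-- Relates the letters at two increasing indices; `adjacent` records that these are known to be
-- consecutive. The first three relations hold at every distance, whereas alternation says nothing
-- when the distance is unknown. Alternation serves the sets with `12-3` and `32-1`, whose shape
-- makes the indices consecutive on the left side.
Link : Rule → (adjacent : Bool) → Bool → Bool → Set
Link constant    _     a b = a ≡ b
Link headFree    _     a b = b ≡ false
Link lastFree    _     a b = a ≡ false
Link alternating true  a b = b ≡ not a
Link alternating false a b = ⊤

link? : ∀ ρ adjacent a b → Dec (Link ρ adjacent a b)
link? constant    _     a b = a Bool.≟ b
link? headFree    _     a b = b Bool.≟ false
link? lastFree    _     a b = a Bool.≟ false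
link? alternating true  a b = b Bool.≟ not a
link? alternating false a b = yes tt

-- Words are indexed by 0, …, m.
free : Rule → ℕ → ℕ
free lastFree m = m
free _        m = 0

word : Rule → ℕ → Bool → ℕ → Bool
word constant    m b t       = b
word headFree    m b zero    = b
word headFree    m b (suc t) = false
word lastFree    m b t       = (t ≡ᵇ m) ∧ b
word alternating m b zero    = b
word alternating m b (suc t) = not (word alternating m b t)

≡ᵇ-refl : ∀ m → (m ≡ᵇ m) ≡ true
≡ᵇ-refl zero    = refl
≡ᵇ-refl (suc m) = ≡ᵇ-refl m

<⇒≡ᵇ-false : ∀ {t m} → t < m → (t ≡ᵇ m) ≡ false
<⇒≡ᵇ-false {zero}  {suc m} _         = refl
<⇒≡ᵇ-false {suc t} {suc m} (s≤s t<m) = <⇒≡ᵇ-false t<m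

free-≤ : ∀ ρ m → free ρ m ≤ m
free-≤ constant    m = z≤n
free-≤ headFree    m = z≤n
free-≤ lastFree    m = ℕ.≤-refl
free-≤ alternating m = z≤n

word-free : ∀ ρ m b → word ρ m b (free ρ m) ≡ b
word-free constant    m b = refl
word-free headFree    m b = refl
word-free lastFree    m b rewrite ≡ᵇ-refl m = refl
word-free alternating m b = refl

word-links : ∀ ρ {m} b {t t′} adjacent → t < t′ → t′ ≤ m → (adjacent ≡ true → t′ ≡ suc t) →
             Link ρ adjacent (word ρ m b t) (word ρ m b t′)
word-links constant    b adjacent t<t′ t′≤m adj = refl
word-links headFree    b {t′ = suc _} adjacent t<t′ t′≤m adj = refl
word-links lastFree    b adjacent t<t′ t′≤m adj
  -- The earlier of two indices is never the last one, hence not the free one.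
  rewrite <⇒≡ᵇ-false (ℕ.<-≤-trans t<t′ t′≤m) = refl
word-links alternating b true  t<t′ t′≤m adj rewrite adj refl = refl
word-links alternating b false t<t′ t′≤m adj = tt

linked⇒word : ∀ ρ m (a : ℕ → Bool) → (∀ {t} → t < m → Link ρ true (a t) (a (suc t))) →
              ∀ {t} → t ≤ m → a t ≡ word ρ m (a (free ρ m)) t
linked⇒word constant m a link {zero}  _   = refl
linked⇒word constant m a link {suc t} t<m =
  trans (sym (link t<m)) (linked⇒word constant m a link (ℕ.<⇒≤ t<m))
linked⇒word headFree m a link {zero}  _   = refl
linked⇒word headFree m a link {suc t} t<m = link t<m
linked⇒word lastFree m a link {t} t≤m with ℕ.m≤n⇒m<n∨m≡n t≤m
... | inj₁ t<m rewrite <⇒≡ᵇ-false t<m = link t<m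
... | inj₂ refl rewrite ≡ᵇ-refl t = refl
linked⇒word alternating m a link {zero}  _   = refl
linked⇒word alternating m a link {suc t} t<m =
  trans (link t<m) (cong not (linked⇒word alternating m a link (ℕ.<⇒≤ t<m)))

-- Pattern sets

-- The shape is disregarded: three consecutive positions are admissible for both shapes, and
-- comparisons propagate by an induction available for either shape.
Covers : List GenPattern → Vec (Fin 3) 3 → Set
Covers P l = Any (λ p → letters p ≡ l) P

-- The triple in which the comparison b of key s i j is not passed on.
broken : Side → Bool → Vec (Fin 3) 3
broken left  true  = letters 2-31
broken left  false = letters 2-13
broken right true  = letters 3-12
broken right false = letters 1-32

broken-isoˡ : ∀ {n} b {x y z : Fin n} → Compare b x y → Compare b z x →
              OrderIsomorphic (x ∷ y ∷ z ∷ []) (broken left b)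
broken-isoˡ true  x<y z<x = sorted-iso z<x x<y (letters 2-31)
broken-isoˡ false y<x x<z = sorted-iso y<x x<z (letters 2-13)

broken-isoʳ : ∀ {n} b {x y z : Fin n} → Compare b y z → Compare b z x →
              OrderIsomorphic (x ∷ y ∷ z ∷ []) (broken right b)
broken-isoʳ true  y<z z<x = sorted-iso y<z z<x (letters 3-12)
broken-isoʳ false z<y x<z = sorted-iso x<z z<y (letters 1-32)

-- Whether the shape makes the indices key s i j and key s j k consecutive.
adjacent : Side → Shape → Bool
adjacent left  ab-c = true
adjacent left  a-bc = false
adjacent right ab-c = false
adjacent right a-bc = true

-- Ranging over all linked pairs of letters, instead of those of one word, leaves four cases for
-- every length at once.
Admits : Side → Rule → GenPattern → Set
Admits s ρ p = ∀ a b → Link ρ (adjacent s (shape p)) a b →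
  ¬ OrderIsomorphic (triple s a b) (letters p)

-- The first clause makes an avoiding permutation governed by its ascents, the second makes these
-- ascents obey the rule.
Forces : List GenPattern → Side → Rule → Set
Forces P s ρ =
  (∀ b → Covers P (broken s b)) ×
  (∀ a b → Link ρ true a b ⊎ Covers P (triple s a b))

Placed : Shape → (i j k : ℕ) → Set
Placed a-bc i j k = (i < j) × (k ≡ suc j)
Placed ab-c i j k = (j ≡ suc i) × (j < k)

placed-< : ∀ sh {i j k} → Placed sh i j k → i < j × j < k
placed-< a-bc (i<j , refl) = i<j , ℕ.≤-refl
placed-< ab-c (refl , j<k) = ℕ.≤-refl , j<k

admissible⇒placed : ∀ {n} sh {i j k : Fin n} → Admissible sh i j k →
                    Placed sh (toℕ i) (toℕ j) (toℕ k)
admissible⇒placed a-bc a = a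
admissible⇒placed ab-c a = a

placed⇒admissible : ∀ {n} sh {i j k : Fin n} → Placed sh (toℕ i) (toℕ j) (toℕ k) →
                    Admissible sh i j k
placed⇒admissible a-bc a = a
placed⇒admissible ab-c a = a

-- Ascent words of avoiding permutations

module _ {m : ℕ} (π : Permutation′ (2+ m)) where

  -- Reduction modulo the length makes positions plain naturals, so that inductions on them carry no
  -- bounds in their types; only positions below `2+ m` are meaningful.
  at : ℕ → Fin (2+ m)
  at t = π ⟨$⟩ʳ (t mod 2+ m)

  ascent : ℕ → Bool
  ascent t = does (at t <? at (suc t))

  toℕ-mod : ∀ {t} → t < 2+ m → toℕ (t mod 2+ m) ≡ t
  toℕ-mod t<n = trans (Fin.toℕ-fromℕ< _) (m<n⇒m%n≡m t<n)

  at-toℕ : ∀ i → at (toℕ i) ≡ π ⟨$⟩ʳ i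
  at-toℕ i = cong (π ⟨$⟩ʳ_) (Fin.toℕ-injective (toℕ-mod (Fin.toℕ<n i)))

  at-distinct : ∀ {i j} → i < j → j < 2+ m → at i ≢ at j
  at-distinct i<j j<n ati≡atj = ℕ.<⇒≢ i<j
    (trans (sym (toℕ-mod (ℕ.<-trans i<j j<n)))
      (trans (cong toℕ (⟨$⟩ʳ-injective π ati≡atj)) (toℕ-mod j<n)))

  ascent-compare : ∀ {t} → suc t < 2+ m → Compare (ascent t) (at t) (at (suc t))
  ascent-compare st<n = compare-does (at-distinct ℕ.≤-refl st<n)

  follows-at : ∀ {s w} → Follows s w π → ∀ {i j} → i < j → j < 2+ m →
               Compare (w (key s i j)) (at i) (at j)
  follows-at {s} {w} follows {i} {j} i<j j<n =
    subst₂ (λ i′ j′ → Compare (w (key s i′ j′)) (at i) (at j))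
      (toℕ-mod i<n) (toℕ-mod j<n)
      (follows (subst₂ _<_ (sym (toℕ-mod i<n)) (sym (toℕ-mod j<n)) i<j))
    where i<n = ℕ.<-trans i<j j<n

  -- At the neighbouring positions t and t + 1 the key is t on both sides.
  follows-ascent : ∀ {s w} → Follows s w π → ∀ {t} → t ≤ m → ascent t ≡ w t
  follows-ascent {left}  {w} follows t≤m =
    does-compare _ (follows-at {left} {w} follows ℕ.≤-refl (s≤s (s≤s t≤m)))
  follows-ascent {right} {w} follows t≤m =
    does-compare _ (follows-at {right} {w} follows ℕ.≤-refl (s≤s (s≤s t≤m)))

  contains : ∀ p {i j k} → Placed (shape p) i j k → k < 2+ m →
             OrderIsomorphic (at i ∷ at j ∷ at k ∷ []) (letters p) → Contains π p
  contains p {i} {j} {k} placed k<n iso =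
    i mod 2+ m , j mod 2+ m , k mod 2+ m , placed⇒admissible (shape p) placed-mod , iso
    where
    placed-mod : Placed (shape p) (toℕ (i mod 2+ m)) (toℕ (j mod 2+ m)) (toℕ (k mod 2+ m))
    placed-mod
      using i<j , j<k ← placed-< (shape p) placed
      rewrite toℕ-mod (ℕ.<-trans i<j (ℕ.<-trans j<k k<n))
            | toℕ-mod (ℕ.<-trans j<k k<n)
            | toℕ-mod k<n = placed

  -- Induction moves j to the right. If j + 1 were the first failure, the positions i, j, j + 1
  -- would form the broken triple in shape `a-bc`, and i, i + 1, j + 1 would form it in shape
  -- `ab-c`.
  propagateˡ : ∀ p b → letters p ≡ broken left b → Avoids π p → ∀ {i j} → suc i ≤′ j → j < 2+ m →
               Compare b (at i) (at (suc i)) → Compare b (at i) (at j)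
  propagateˡ p b letters≡ avoids (≤′-reflexive refl) j<n base = base
  propagateˡ p b letters≡ avoids {i} {suc j} (≤′-step i<′j) j+1<n base
    with compare-total b (at-distinct (ℕ.m<n⇒m<1+n (ℕ.≤′⇒≤ i<′j)) j+1<n)
  ... | inj₁ ok = ok
  propagateˡ p@(pattern′ a-bc _) b refl avoids {i} {suc j} (≤′-step i<′j) j+1<n base | inj₂ bad =
    contradiction
      (contains p (ℕ.≤′⇒≤ i<′j , refl) j+1<n (broken-isoˡ b
        (propagateˡ p b refl avoids i<′j (ℕ.<-trans ℕ.≤-refl j+1<n) base) bad))
      avoids
  propagateˡ p@(pattern′ ab-c _) b refl avoids {i} {suc j} (≤′-step i<′j) j+1<n base | inj₂ bad =
    contradiction
      (contains p (refl , s≤s (ℕ.≤′⇒≤ i<′j)) j+1<n (broken-isoˡ b base bad))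
      avoids

  -- The mirror argument: the step of `≤‴` lowers the left end i. A failure at i occupies i, k, k +
  -- 1 in shape `a-bc` and i, i + 1, k + 1 in shape `ab-c`.
  propagateʳ : ∀ p b → letters p ≡ broken right b → Avoids π p → ∀ {i k} → i ≤‴ k → suc k < 2+ m →
               Compare b (at k) (at (suc k)) → Compare b (at i) (at (suc k))
  propagateʳ p b letters≡ avoids ≤‴-refl k<n base = base
  propagateʳ p b letters≡ avoids {i} {k} (≤‴-step i<‴k) k+1<n base
    with compare-total b (at-distinct (ℕ.m<n⇒m<1+n (ℕ.≤‴⇒≤ i<‴k)) k+1<n)
  ... | inj₁ ok = ok
  propagateʳ p@(pattern′ a-bc _) b refl avoids {i} {k} (≤‴-step i<‴k) k+1<n base | inj₂ bad =
    contradiction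
      (contains p (ℕ.≤‴⇒≤ i<‴k , refl) k+1<n (broken-isoʳ b base bad))
      avoids
  propagateʳ p@(pattern′ ab-c _) b refl avoids {i} {k} (≤‴-step i<‴k) k+1<n base | inj₂ bad =
    contradiction
      (contains p (refl , s≤s (ℕ.≤‴⇒≤ i<‴k)) k+1<n (broken-isoʳ b
        (propagateʳ p b refl avoids i<‴k k+1<n base) bad))
      avoids

  module _ {P} (avoids : All (Avoids π) P) where

    avoids-cover : ∀ {l} → Covers P l → ∃[ p ] letters p ≡ l × Avoids π p
    avoids-cover cover with find cover
    ... | p , p∈P , letters≡ = p , letters≡ , All.lookup avoids p∈P

    follows-ascents : ∀ s → (∀ b → Covers P (broken s b)) → Follows s ascent π
    follows-ascents s covers {i} {j} i<j =
      subst₂ (Compare (ascent (key s (toℕ i) (toℕ j)))) (at-toℕ i) (at-toℕ j)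
        (compare s i<j (Fin.toℕ<n j) (avoids-cover (covers (ascent (key s (toℕ i) (toℕ j))))))
      where
      compare : ∀ s {i j} → i < j → j < 2+ m →
        ∃[ p ] letters p ≡ broken s (ascent (key s i j)) × Avoids π p →
        Compare (ascent (key s i j)) (at i) (at j)
      compare left i<j j<n (p , letters≡ , avoid) =
        propagateˡ p _ letters≡ avoid (ℕ.≤⇒≤′ i<j) j<n (ascent-compare (ℕ.≤-<-trans i<j j<n))
      compare right {j = suc k} (s≤s i≤k) j<n (p , letters≡ , avoid) =
        propagateʳ p _ letters≡ avoid (ℕ.≤⇒≤‴ i≤k) j<n (ascent-compare j<n)

    -- A transition outside the rule would make the positions t, t + 1, t + 2 an occurrence of a
    -- pattern of `P`, whatever its shape.
    ascents-linked : ∀ s ρ → Forces P s ρ → ∀ {t} → t < m → Link ρ true (ascent t) (ascent (suc t))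
    ascents-linked s ρ (covers , linked) {t} t<m with linked (ascent t) (ascent (suc t))
    ... | inj₁ link = link
    ... | inj₂ cover with avoids-cover cover
    ...   | p , letters≡ , avoid = contradiction
            (contains p (consecutive (shape p)) t+2<n
              (subst (OrderIsomorphic (at t ∷ at (suc t) ∷ at (2+ t) ∷ [])) (sym letters≡) (iso s covers)))
            avoid
      where
      t+2<n : 2+ t < 2+ m
      t+2<n = s≤s (s≤s t<m)

      consecutive : ∀ sh → Placed sh t (suc t) (2+ t)
      consecutive a-bc = ℕ.≤-refl , refl
      consecutive ab-c = refl , ℕ.≤-refl

      t<t+1 = ℕ.n<1+n t
      t<t+2 = ℕ.m<n⇒m<1+n t<t+1
      t+1<t+2 = ℕ.n<1+n (suc t)
      t+1<n = ℕ.<-trans t+1<t+2 t+2<n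

      iso : ∀ s → (∀ b → Covers P (broken s b)) →
            OrderIsomorphic (at t ∷ at (suc t) ∷ at (2+ t) ∷ [])
              (triple s (ascent t) (ascent (suc t)))
      iso left covers = triple-isoˡ _ _ (compare t<t+1 t+1<n) (compare t<t+2 t+2<n) (compare t+1<t+2 t+2<n)
        where
        compare : ∀ {i j} → i < j → j < 2+ m → Compare (ascent i) (at i) (at j)
        compare = follows-at {left} {ascent} (follows-ascents left covers)
      iso right covers = triple-isoʳ _ _ (compare t<t+1 t+1<n) (compare t<t+2 t+2<n) (compare t+1<t+2 t+2<n)
        where
        compare : ∀ {i j} → i < j → j < 2+ m → Compare (ascent (pred j)) (at i) (at j)
        compare = follows-at {right} {ascent} (follows-ascents right covers)

    forces⇒follows : ∀ s ρ → Forces P s ρ → Follows s (word ρ m (ascent (free ρ m))) π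
    forces⇒follows s ρ forces {i} {j} i<j =
      subst (λ b → Compare b (π ⟨$⟩ʳ i) (π ⟨$⟩ʳ j))
        (linked⇒word ρ m ascent (ascents-linked s ρ forces) (key-≤ s i<j (Fin.toℕ<n j)))
        (follows-ascents s (proj₁ forces) i<j)

-- Avoidance by the arranged permutations and the count

key-adjacent : ∀ s sh {i j k} → i < j → Placed sh i j k → adjacent s sh ≡ true →
               key s j k ≡ suc (key s i j)
key-adjacent left  ab-c i<j (refl , _) _ = refl
key-adjacent right a-bc {j = suc j} i<j (_ , refl) _ = refl

-- An occurrence of `p` would be order-isomorphic both to `p` and to the triple read off from two
-- linked letters of the word, which `Admits` excludes.
arrange-avoids : ∀ s ρ {m} b p → Admits s ρ p → Avoids (arrange s (2+ m) (word ρ m b)) p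
arrange-avoids s ρ {m} b p admits (i , j , k , admissible , iso) =
  admits _ _
    (word-links ρ b (adjacent s (shape p)) (key-< s i<j j<k) (key-≤ s j<k (Fin.toℕ<n k))
      (key-adjacent s (shape p) i<j placed))
    (iso-sym-trans (map (σ ⟨$⟩ʳ_) (i ∷ j ∷ k ∷ [])) (triple s _ _) (letters p)
      (follows-triple s w σ (arrange-follows s (2+ m) w) i<j j<k) iso)
  where
  w = word ρ m b
  σ = arrange s (2+ m) w
  placed = admissible⇒placed (shape p) admissible
  i<j = proj₁ (placed-< (shape p) placed)
  j<k = proj₂ (placed-< (shape p) placed)

Determines : List GenPattern → Side × Rule → Set
Determines P (s , ρ) = Forces P s ρ × All (Admits s ρ) P

-- The bijection with `Bool` reads the ascent at the free index. An avoiding permutation follows the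
-- word of that letter, as the candidate does, so uniqueness identifies the two.
determines⇒two : ∀ {P s ρ} → Determines P (s , ρ) → ∀ m → ∣ S (2+ m) P ∣≡ 2
determines⇒two {P} {s} {ρ} (forces , admits) m = Composition.inverse 2↔Bool record
  { to        = λ b → candidate b , All.map (λ {p} → arrange-avoids s ρ b p) admits
  ; from      = λ (π , _) → ascent π (free ρ m)
  ; to-cong   = λ { refl i → refl }
  ; from-cong = λ {(π , _)} {(σ , _)} π≗σ → ascent-cong π σ π≗σ
  ; inverse   = (λ { {π , avoids} refl → follows-unique s (word ρ m _) (candidate _) π
                      (candidate-follows _) (forces⇒follows π avoids s ρ forces) })
              , (λ { {b} {π , _} π≗ → trans (ascent-cong π (candidate b) π≗)
                      (trans (follows-ascent (candidate b) {s} {word ρ m b} (candidate-follows b) (free-≤ ρ m))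
                             (word-free ρ m b)) })
  }
  where
  candidate : Bool → Permutation′ (2+ m)
  candidate b = arrange s (2+ m) (word ρ m b)

  candidate-follows : ∀ b → Follows s (word ρ m b) (candidate b)
  candidate-follows b = arrange-follows s (2+ m) (word ρ m b)

  ascent-cong : ∀ (π σ : Permutation′ (2+ m)) → (∀ i → π ⟨$⟩ʳ i ≡ σ ⟨$⟩ʳ i) →
                ascent π (free ρ m) ≡ ascent σ (free ρ m)
  ascent-cong π σ π≗σ = cong₂ (λ x y → does (x <? y)) (π≗σ _) (π≗σ _)

-- Classification of the listed sets

Bool-all? : {P : Bool → Set} → (∀ b → Dec (P b)) → Dec (∀ b → P b)
Bool-all? P? = map′ (λ { (t , f) true → t ; (t , f) false → f }) (λ h → h true , h false)
  (P? true ×-dec P? false)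

covers? : ∀ P l → Dec (Covers P l)
covers? P l = Any.any? (λ p → ≡-dec Fin._≟_ (letters p) l) P

determines? : ∀ P sρ → Dec (Determines P sρ)
determines? P (s , ρ) =
  (Bool-all? (λ b → covers? P (broken s b)) ×-dec
   Bool-all? (λ a → Bool-all? λ b → link? ρ true a b ⊎-dec covers? P (triple s a b))) ×-dec
  All.all? (λ p → Bool-all? λ a → Bool-all? λ b →
    link? ρ (adjacent s (shape p)) a b →-dec ¬? (triple s a b ≅? letters p)) P

-- The permutations besides the decreasing one are, in this order,
-- 1 n ⋯ 2, n ⋯ 3 1 2, (n−1) n (n−2) ⋯ 1, (n−1) ⋯ 1 n and 1 ⋯ n; the last entry
-- gives 1 n 2 (n−1) ⋯ and n 1 (n−1) 2 ⋯.
cases : List (Side × Rule)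
cases = (left , headFree) ∷ (left , lastFree) ∷ (right , headFree) ∷ (right , lastFree) ∷
        (left , constant) ∷ (left , alternating) ∷ []

Determined : List GenPattern → Set
Determined P = Any (Determines P) cases

determined? : ∀ P → Dec (Determined P)
determined? P = Any.any? (determines? P) cases

-- The implicit argument is solved by evaluating the decision procedure during type checking; the
-- variants below treat all choices of x and y at once.
by-decision : ∀ P → {True (determined? P)} → Determined P
by-decision P {d} = toWitness d

by-decision₁ : ∀ {xs} (P : GenPattern → List GenPattern) →
               {True (All.all? (λ x → determined? (P x)) xs)} →
               ∀ {x} → x ∈ xs → Determined (P x)
by-decision₁ P {d} = All.lookup (toWitness d)

by-decision₂ : ∀ {xs ys} (P : GenPattern → GenPattern → List GenPattern) →
               {True (All.all? (λ x → All.all? (λ y → determined? (P x y)) ys) xs)} →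
               ∀ {x y} → x ∈ xs → y ∈ ys → Determined (P x y)
by-decision₂ P {d} x∈ = All.lookup (All.lookup (toWitness d) x∈)

listed⇒determined : ∀ {r Q} → Listed r Q → Determined (r ∷ Q)
listed⇒determined (a₁ x∈ y∈) = by-decision₂ (λ x y → 21-3 ∷ 1-23 ∷ 2-13 ∷ x ∷ y ∷ []) x∈ y∈
listed⇒determined (a₂ x∈ y∈) = by-decision₂ (λ x y → 21-3 ∷ 1-23 ∷ 2-13 ∷ x ∷ y ∷ []) x∈ y∈
listed⇒determined (a₃ x∈)    = by-decision₁ (λ x → 21-3 ∷ 12-3 ∷ 2-13 ∷ x ∷ 32-1 ∷ []) x∈
listed⇒determined a₄         = by-decision _
listed⇒determined a₅         = by-decision _
listed⇒determined a₆         = by-decision _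
listed⇒determined (a₇ x∈ y∈) = by-decision₂ (λ x y → 21-3 ∷ 2-13 ∷ 23-1 ∷ x ∷ y ∷ []) x∈ y∈
listed⇒determined (b₁ x∈)    = by-decision₁ (λ x → 3-12 ∷ 1-23 ∷ 2-13 ∷ x ∷ 31-2 ∷ []) x∈
listed⇒determined (b₂ x∈)    = by-decision₁ (λ x → 3-12 ∷ 1-23 ∷ 21-3 ∷ x ∷ 31-2 ∷ []) x∈
listed⇒determined (b₃ x∈)    = by-decision₁ (λ x → 3-12 ∷ 1-23 ∷ 2-31 ∷ x ∷ 31-2 ∷ []) x∈
listed⇒determined (b₄ x∈)    = by-decision₁ (λ x → 3-12 ∷ 1-23 ∷ 23-1 ∷ x ∷ 31-2 ∷ []) x∈
listed⇒determined c₁         = by-decision _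
listed⇒determined (c₂ x∈ y∈) = by-decision₂ (λ x y → 23-1 ∷ 1-23 ∷ 2-31 ∷ x ∷ y ∷ []) x∈ y∈
listed⇒determined (c₃ x∈)    = by-decision₁ (λ x → 23-1 ∷ 1-23 ∷ 21-3 ∷ 2-31 ∷ x ∷ []) x∈
listed⇒determined (c₄ x∈)    = by-decision₁ (λ x → 23-1 ∷ 1-23 ∷ 2-13 ∷ 2-31 ∷ x ∷ []) x∈
listed⇒determined (d₁ x∈)    = by-decision₁ (λ x → 1-32 ∷ 1-23 ∷ 2-13 ∷ x ∷ 13-2 ∷ []) x∈
listed⇒determined (d₂ x∈)    = by-decision₁ (λ x → 1-32 ∷ 1-23 ∷ 21-3 ∷ x ∷ 13-2 ∷ []) x∈
listed⇒determined (d₃ x∈)    = by-decision₁ (λ x → 1-32 ∷ 1-23 ∷ 2-31 ∷ 13-2 ∷ x ∷ []) x∈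
listed⇒determined (d₄ x∈)    = by-decision₁ (λ x → 1-32 ∷ 1-23 ∷ 23-1 ∷ 13-2 ∷ x ∷ []) x∈
listed⇒determined (e₁ x∈ y∈) = by-decision₂ (λ x y → 12-3 ∷ 1-23 ∷ 2-13 ∷ x ∷ y ∷ []) x∈ y∈
listed⇒determined (e₂ x∈)    = by-decision₁ (λ x → 12-3 ∷ 1-23 ∷ 2-13 ∷ 1-32 ∷ x ∷ []) x∈
listed⇒determined (e₃ x∈ y∈) = by-decision₂ (λ x y → 12-3 ∷ 1-23 ∷ 21-3 ∷ x ∷ y ∷ []) x∈ y∈

mainTheorem14 : (r : GenPattern) (Q : List GenPattern) → Listed r Q →
    ∃[ k ] ((n : ℕ) → n ≥ k → ∣ S n (r ∷ Q) ∣≡ 2)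
mainTheorem14 r Q listed with Any.satisfied (listed⇒determined listed)
-- Length two is the least at which there is an ascent, and so a free letter.
... | (s , ρ) , determines = 2 , λ { 1 (s≤s ()) ; (2+ m) _ → determines⇒two determines m }
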